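{- Let $m$ be a positive integer which is not of the form $2^l - 1$ with $l$ a natural number, and let $C = A \cap [0, m]$ and $D = B \cap [0, m]$. Then there exists a positive integer $n$ with $m < n < 2m$ such that $R_{C}(n) \ne R_{D}(n)$.
   Context: Natural numbers are nonnegative integers, $\mathbb{N} = \{0,1,2,\dots\}$, and $[a,b]$ denotes the set of integers $x$ with $a \le x \le b$. For a set $S$ of nonnegative integers, $R_S(n)$ denotes the number of solutions of $s + s' = n$ with $s, s' \in S$ and $s < s'$. $A$ is the set of those nonnegative integers whose binary representation contains an even number of digits $1$ (so $0 \in A$), and $B = \mathbb{N} \setminus A$. -}

module Defs where

open import Data.Digit using (Bit; 1b; toDigits)
open import Data.Fin.Properties using () renaming (_≟_ to _≟ᶠ_)
open import Data.List.Base using (List; length; filter; upTo; cartesianProduct)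
open import Data.Nat.Base using (ℕ; suc; _+_; _≤_; _<_)
open import Data.Nat.Divisibility using (_∣_; _∣?_)
open import Data.Nat.Properties using (_≟_; _≤?_; _<?_)
open import Data.Product.Base using (_×_; _,_; proj₁)
open import Level using (0ℓ)
open import Relation.Binary.PropositionalEquality using (_≡_)
open import Relation.Nullary.Decidable using (_×-dec_)
open import Relation.Unary using (Pred; Decidable; _∩_; ∁)
open import Relation.Unary.Properties using (_∩?_; ∁?)

bits : ℕ → List Bit
bits n = proj₁ (toDigits 2 n)

ones : ℕ → ℕ
ones n = length (filter (_≟ᶠ 1b) (bits n))

A : Pred ℕ 0ℓ
A n = 2 ∣ ones n

A? : Decidable A
A? n = 2 ∣? ones n

B : Pred ℕ 0ℓ
B = ∁ A

B? : Decidable B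
B? = ∁? A?

Interval : ℕ → ℕ → Pred ℕ 0ℓ
Interval a b x = a ≤ x × x ≤ b

Interval? : ∀ a b → Decidable (Interval a b)
Interval? a b x = (a ≤? x) ×-dec (x ≤? b)

C : ℕ → Pred ℕ 0ℓ
C m = A ∩ Interval 0 m

C? : ∀ m → Decidable (C m)
C? m = A? ∩? Interval? 0 m

D : ℕ → Pred ℕ 0ℓ
D m = B ∩ Interval 0 m

D? : ∀ m → Decidable (D m)
D? m = B? ∩? Interval? 0 m

Solution : Pred ℕ 0ℓ → ℕ → Pred (ℕ × ℕ) 0ℓ
Solution S n (s , s′) = S s × S s′ × s + s′ ≡ n × s < s′

Solution? : ∀ {S} → Decidable S → ∀ n → Decidable (Solution S n)
Solution? S? n (s , s′) = S? s ×-dec S? s′ ×-dec (s + s′ ≟ n) ×-dec (s <? s′)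

-- Every solution of s + s′ = n has s, s′ ≤ n, and the pairs listed here are
-- pairwise distinct, so the length is the number of all solutions.
R : ∀ {S} → Decidable S → ℕ → ℕ
R S? n =
  length (filter (Solution? S? n) (cartesianProduct (upTo (suc n)) (upTo (suc n))))

{-# OPTIONS --safe #-}

-- Let t be the Thue–Morse sign, +1 on A and −1 on B.  A pair with entries in
-- [0, m] contributes (t s + t s′) / 2 to R_C(n) − R_D(n), so for n = m + k with
-- 0 ≤ k ≤ m twice this difference is the sum of t over [k, m] minus the
-- diagonal term t (n / 2) (absent for odd n).  Partial sums of t of even length
-- vanish.  For m even, k = 1 or k = 3 gives a nonzero value.  For m = 2 p − 1 and
-- k = 2 j + 1 the value is − t j − t (p + j), and it remains to find j ≤ p − 2
-- with t (p + j) = t j unless p is a power of 2; halving p reduces this to odd p.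

module Submission where

open import Defs
open import Data.Digit using (Bit; 1b; fromDigits; toDigits)
open import Data.Fin.Base using (zero; suc; toℕ)
open import Data.Fin.Properties using () renaming (_≟_ to _≟ᶠ_)
open import Data.Integer.Base as ℤ using (ℤ; +_; 0ℤ; 1ℤ; -1ℤ)
import Data.Integer.Properties as ℤ
import Data.Integer.Tactic.RingSolver as ℤ-Solver
open import Data.List.Base
  using (List; []; _∷_; _++_; _∷ʳ_; length; filter; map; upTo; cartesianProduct)
open import Data.List.Membership.Propositional using (_∈_)
open import Data.List.Membership.Propositional.Properties using (∈-upTo⁻)
open import Data.List.Properties using (upTo-∷ʳ)
open import Data.List.Relation.Unary.Any using (here; there)
open import Data.Nat.Base
  using (ℕ; zero; suc; _+_; _*_; _^_; _∸_; _≤_; _<_; z≤n; s≤s; s<s; z<s)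
open import Data.Nat.Divisibility
  using (_∣_; _∣?_; _∣0; ∣-refl; ∣1⇒≡1; ∣m∣n⇒∣m+n; ∣m+n∣m⇒∣n)
open import Data.Nat.DivMod using (DivMod; _divMod_; result)
open import Data.Nat.Induction using (<-rec)
open import Data.Nat.Properties
open import Data.Nat.Tactic.RingSolver using (solve-∀)
open import Data.Product.Base using (∃; _×_; _,_; proj₂)
open import Data.Sum.Base using (_⊎_; inj₁; inj₂)
open import Level using (Level)
open import Relation.Binary.Definitions using (Tri; tri<; tri≈; tri>)
open import Relation.Binary.PropositionalEquality
open import Relation.Nullary.Decidable using (Dec; yes; no; _×-dec_; ¬?)
open import Relation.Nullary.Negation.Core using (¬_; contradiction)
open import Relation.Unary using (Pred; Decidable)

private
  variable
    a b p q : Level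
    X : Set a
    Y : Set b
    P : Set p
    Q : Set q

-- Integer-valued indicators of decidable propositions.

𝟙 : Dec P → ℤ
𝟙 (yes _) = 1ℤ
𝟙 (no _)  = 0ℤ

𝟙-yes : (d : Dec P) → P → 𝟙 d ≡ 1ℤ
𝟙-yes (yes _) _ = refl
𝟙-yes (no ¬x) x = contradiction x ¬x

𝟙-no : (d : Dec P) → ¬ P → 𝟙 d ≡ 0ℤ
𝟙-no (yes x) ¬x = contradiction x ¬x
𝟙-no (no _)  _  = refl

𝟙-× : (d : Dec P) (e : Dec Q) → 𝟙 (d ×-dec e) ≡ 𝟙 d ℤ.* 𝟙 e
𝟙-× (yes _) (yes _) = refl
𝟙-× (yes _) (no _)  = refl
𝟙-× (no _)  (yes _) = refl
𝟙-× (no _)  (no _)  = refl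

𝟙-¬ : (d : Dec P) → 𝟙 (¬? d) ≡ 1ℤ ℤ.- 𝟙 d
𝟙-¬ (yes _) = refl
𝟙-¬ (no _)  = refl

-- Finite sums of integers

∑ : List X → (X → ℤ) → ℤ
∑ []       f = 0ℤ
∑ (x ∷ xs) f = f x ℤ.+ ∑ xs f

infix 6.5 ∑
syntax ∑ xs (λ x → e) = ∑[ x ← xs ] e

∑-cong : ∀ (xs : List X) {f g} → (∀ {x} → x ∈ xs → f x ≡ g x) → ∑ xs f ≡ ∑ xs g
∑-cong []       f≗g = refl
∑-cong (x ∷ xs) f≗g = cong₂ ℤ._+_ (f≗g (here refl)) (∑-cong xs (λ i → f≗g (there i)))

∑-zero : ∀ (xs : List X) {f} → (∀ {x} → x ∈ xs → f x ≡ 0ℤ) → ∑ xs f ≡ 0ℤ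
∑-zero []       f≗0 = refl
∑-zero (x ∷ xs) f≗0 = cong₂ ℤ._+_ (f≗0 (here refl)) (∑-zero xs (λ i → f≗0 (there i)))

interchange : ∀ w x y z → (w ℤ.+ x) ℤ.+ (y ℤ.+ z) ≡ (w ℤ.+ y) ℤ.+ (x ℤ.+ z)
interchange = ℤ-Solver.solve-∀

∑-+ : ∀ (xs : List X) (f g : X → ℤ) → ∑[ x ← xs ] (f x ℤ.+ g x) ≡ ∑ xs f ℤ.+ ∑ xs g
∑-+ []       f g = refl
∑-+ (x ∷ xs) f g rewrite ∑-+ xs f g = interchange (f x) (g x) (∑ xs f) (∑ xs g)

∑-neg : ∀ (xs : List X) (f : X → ℤ) → ∑[ x ← xs ] (ℤ.- f x) ≡ ℤ.- ∑ xs f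
∑-neg []       f = refl
∑-neg (x ∷ xs) f rewrite ∑-neg xs f = sym (ℤ.neg-distrib-+ (f x) (∑ xs f))

∑-- : ∀ (xs : List X) (f g : X → ℤ) → ∑[ x ← xs ] (f x ℤ.- g x) ≡ ∑ xs f ℤ.- ∑ xs g
∑-- xs f g = trans (∑-+ xs f (λ x → ℤ.- g x)) (cong (λ z → ∑ xs f ℤ.+ z) (∑-neg xs g))

∑-*ʳ : ∀ (xs : List X) (f : X → ℤ) c → ∑[ x ← xs ] (f x ℤ.* c) ≡ ∑ xs f ℤ.* c
∑-*ʳ []       f c = refl
∑-*ʳ (x ∷ xs) f c rewrite ∑-*ʳ xs f c = sym (ℤ.*-distribʳ-+ c (f x) (∑ xs f))

∑-++ : ∀ (xs ys : List X) f → ∑ (xs ++ ys) f ≡ ∑ xs f ℤ.+ ∑ ys f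
∑-++ []       ys f = sym (ℤ.+-identityˡ _)
∑-++ (x ∷ xs) ys f rewrite ∑-++ xs ys f = sym (ℤ.+-assoc (f x) (∑ xs f) (∑ ys f))

∑-map : ∀ (g : X → Y) xs f → ∑ (map g xs) f ≡ ∑[ x ← xs ] f (g x)
∑-map g []       f = refl
∑-map g (x ∷ xs) f = cong (λ z → f (g x) ℤ.+ z) (∑-map g xs f)

∑-comm : ∀ (xs : List X) (ys : List Y) (f : X → Y → ℤ) →
         ∑[ x ← xs ] ∑[ y ← ys ] f x y ≡ ∑[ y ← ys ] ∑[ x ← xs ] f x y
∑-comm []       ys f = sym (∑-zero ys (λ _ → refl))
∑-comm (x ∷ xs) ys f rewrite ∑-comm xs ys f = sym (∑-+ ys (f x) _)

∑-cartesianProduct : ∀ (xs : List X) (ys : List Y) f →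
  ∑ (cartesianProduct xs ys) f ≡ ∑[ x ← xs ] ∑[ y ← ys ] f (x , y)
∑-cartesianProduct []       ys f = refl
∑-cartesianProduct (x ∷ xs) ys f =
  trans (∑-++ (map (x ,_) ys) (cartesianProduct xs ys) f)
        (cong₂ ℤ._+_ (∑-map (x ,_) ys f) (∑-cartesianProduct xs ys f))

length-filter-∑ : ∀ {P : Pred X p} (P? : Decidable P) xs →
                  + length (filter P? xs) ≡ ∑[ x ← xs ] 𝟙 (P? x)
length-filter-∑ P? []       = refl
length-filter-∑ P? (x ∷ xs) with P? x
... | yes _ = cong (λ z → 1ℤ ℤ.+ z) (length-filter-∑ P? xs)
... | no _  = trans (length-filter-∑ P? xs) (sym (ℤ.+-identityˡ _))

∑-upTo-suc : ∀ n f → ∑ (upTo (suc n)) f ≡ ∑ (upTo n) f ℤ.+ f n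
∑-upTo-suc n f = begin
  ∑ (upTo (suc n)) f             ≡⟨ cong (λ xs → ∑ xs f) (upTo-∷ʳ n) ⟨
  ∑ (upTo n ∷ʳ n) f              ≡⟨ ∑-++ (upTo n) (n ∷ []) f ⟩
  ∑ (upTo n) f ℤ.+ (f n ℤ.+ 0ℤ)  ≡⟨ cong (λ z → ∑ (upTo n) f ℤ.+ z) (ℤ.+-identityʳ (f n)) ⟩
  ∑ (upTo n) f ℤ.+ f n           ∎
  where open ≡-Reasoning

∑-upTo-single : ∀ {i} n f → i < n → (∀ j → j ≢ i → f j ≡ 0ℤ) → ∑ (upTo n) f ≡ f i
∑-upTo-single {i} (suc n) f i<1+n f≗0 rewrite ∑-upTo-suc n f with n ≟ i
... | yes refl rewrite ∑-zero (upTo n) {f} (λ {j} j∈ → f≗0 j (<⇒≢ (∈-upTo⁻ j∈))) =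
  ℤ.+-identityˡ (f n)
... | no n≢i rewrite f≗0 n n≢i =
  trans (ℤ.+-identityʳ _)
        (∑-upTo-single n f (≤∧≢⇒< (≤-pred i<1+n) (≢-sym n≢i)) f≗0)

-- Writing the range as `d + k` allows induction on the surplus `d`: each extra term has an index at
-- least `k`, so its indicator is 0.
∑-upTo-truncate : ∀ k d f → ∑[ i ← upTo (d + k) ] (𝟙 (i <? k) ℤ.* f i) ≡ ∑ (upTo k) f
∑-upTo-truncate k zero f = ∑-cong (upTo k) λ {i} i∈ →
  trans (cong (ℤ._* f i) (𝟙-yes (i <? k) (∈-upTo⁻ i∈))) (ℤ.*-identityˡ (f i))
∑-upTo-truncate k (suc d) f = begin
  ∑ (upTo (suc (d + k))) g        ≡⟨ ∑-upTo-suc (d + k) g ⟩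
  ∑ (upTo (d + k)) g ℤ.+ g (d + k)
    ≡⟨ cong₂ ℤ._+_ (∑-upTo-truncate k d f)
         (cong (ℤ._* f (d + k)) (𝟙-no (d + k <? k) (≤⇒≯ (m≤n+m k d)))) ⟩
  ∑ (upTo k) f ℤ.+ 0ℤ             ≡⟨ ℤ.+-identityʳ _ ⟩
  ∑ (upTo k) f                    ∎
  where
  open ≡-Reasoning
  g : ℕ → ℤ
  g i = 𝟙 (i <? k) ℤ.* f i

∑-upTo-truncate-≤ : ∀ {k n} f → k ≤ n →
  ∑[ i ← upTo n ] (𝟙 (i <? k) ℤ.* f i) ≡ ∑ (upTo k) f
∑-upTo-truncate-≤ {k} {n} f k≤n =
  subst (λ N → ∑[ i ← upTo N ] (𝟙 (i <? k) ℤ.* f i) ≡ ∑ (upTo k) f)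
        (m∸n+n≡m k≤n) (∑-upTo-truncate k (n ∸ k) f)

-- The Thue–Morse sign

count : List Bit → ℕ
count ds = length (filter (_≟ᶠ 1b) ds)

m*2≢1+n*2 : ∀ m n → m * 2 ≢ suc (n * 2)
m*2≢1+n*2 m n eq =
  even≢odd m n (trans (*-comm 2 m) (trans eq (cong suc (*-comm n 2))))

-- Expansions of the same number differ only in leading zeros.
count-unique : ∀ ds es → fromDigits ds ≡ fromDigits es → count ds ≡ count es
count-unique [] [] eq = refl
count-unique [] (zero ∷ es) eq = count-unique [] es (*-cancelʳ-≡ 0 _ 2 eq)
count-unique (zero ∷ ds) [] eq = count-unique ds [] (*-cancelʳ-≡ _ 0 2 eq)
count-unique (zero ∷ ds) (zero ∷ es) eq = count-unique ds es (*-cancelʳ-≡ _ _ 2 eq)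
count-unique (zero ∷ ds) (suc zero ∷ es) eq =
  contradiction eq (m*2≢1+n*2 (fromDigits ds) (fromDigits es))
count-unique (suc zero ∷ ds) (zero ∷ es) eq =
  contradiction (sym eq) (m*2≢1+n*2 (fromDigits es) (fromDigits ds))
count-unique (suc zero ∷ ds) (suc zero ∷ es) eq =
  cong suc (count-unique ds es (*-cancelʳ-≡ _ _ 2 (suc-injective eq)))

-- Both digit lists have the same value, so `count-unique` applies and the recursion inside
-- `toDigits` never has to be unfolded.
ones-digit : ∀ (d : Bit) n → ones (toℕ d + n * 2) ≡ count (d ∷ bits n)
ones-digit d n = count-unique (bits (toℕ d + n * 2)) (d ∷ bits n)
  (trans (proj₂ (toDigits 2 (toℕ d + n * 2)))
         (cong (λ x → toℕ d + x * 2) (sym (proj₂ (toDigits 2 n)))))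

-- This is (-1)^k, encoded as a difference of indicators so that `t` is definitionally the indicator
-- of `A` minus that of `B`.
sign : ℕ → ℤ
sign k = 𝟙 (2 ∣? k) ℤ.- 𝟙 (¬? (2 ∣? k))

2∣n⊎2∣1+n : ∀ n → 2 ∣ n ⊎ 2 ∣ suc n
2∣n⊎2∣1+n zero = inj₁ (2 ∣0)
2∣n⊎2∣1+n (suc n) with 2∣n⊎2∣1+n n
... | inj₁ 2∣n   = inj₂ (∣m∣n⇒∣m+n ∣-refl 2∣n)
... | inj₂ 2∣1+n = inj₁ 2∣1+n

sign-suc : ∀ k → sign (suc k) ≡ ℤ.- sign k
sign-suc k with 2 ∣? k | 2 ∣? suc k
... | yes _   | no _      = refl
... | no _    | yes _     = refl
... | yes 2∣k | yes 2∣1+k =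
  contradiction (∣1⇒≡1 (∣m+n∣m⇒∣n (subst (2 ∣_) (+-comm 1 k) 2∣1+k) 2∣k)) λ ()
... | no 2∤k  | no 2∤1+k with 2∣n⊎2∣1+n k
...   | inj₁ 2∣k   = contradiction 2∣k 2∤k
...   | inj₂ 2∣1+k = contradiction 2∣1+k 2∤1+k

opaque
  -- Opacity stops `t` from unfolding into digit computations; everything later relies only on the
  -- facts proved in this block.
  t : ℕ → ℤ
  t n = sign (ones n)

  t-def : ∀ n → t n ≡ 𝟙 (A? n) ℤ.- 𝟙 (B? n)
  t-def n = refl

  t-even : ∀ n → t (n * 2) ≡ t n
  t-even n = cong sign (ones-digit zero n)

  t-odd : ∀ n → t (suc (n * 2)) ≡ ℤ.- t n
  t-odd n = trans (cong sign (ones-digit (suc zero) n)) (sign-suc (ones n))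

  t-±1 : ∀ n → t n ≡ 1ℤ ⊎ t n ≡ -1ℤ
  t-±1 n with A? n
  ... | yes _ = inj₁ refl
  ... | no _  = inj₂ refl

  t-0 : t 0 ≡ 1ℤ
  t-0 = refl

t-1 : t 1 ≡ -1ℤ
t-1 = trans (t-odd 0) (cong ℤ.-_ t-0)

t-2 : t 2 ≡ -1ℤ
t-2 = trans (t-even 1) t-1

t-3 : t 3 ≡ 1ℤ
t-3 = trans (t-odd 1) (cong ℤ.-_ t-1)

T : ℕ → ℤ
T k = ∑ (upTo k) t

-- The terms at `2n` and `2n + 1` are `t n` and `− t n`, so consecutive blocks of two cancel. An odd
-- length leaves one unpaired term, `t (2n) = t n`.
T-even : ∀ n → T (n * 2) ≡ 0ℤ
T-odd  : ∀ n → T (suc (n * 2)) ≡ t n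

T-even zero = refl
T-even (suc n) = begin
  T (suc (suc (n * 2)))                ≡⟨ ∑-upTo-suc (suc (n * 2)) t ⟩
  T (suc (n * 2)) ℤ.+ t (suc (n * 2))  ≡⟨ cong₂ ℤ._+_ (T-odd n) (t-odd n) ⟩
  t n ℤ.- t n                          ≡⟨ ℤ.+-inverseʳ (t n) ⟩
  0ℤ                                   ∎
  where open ≡-Reasoning

T-odd n = begin
  T (suc (n * 2))            ≡⟨ ∑-upTo-suc (n * 2) t ⟩
  T (n * 2) ℤ.+ t (n * 2)    ≡⟨ cong₂ ℤ._+_ (T-even n) (t-even n) ⟩
  0ℤ ℤ.+ t n                 ≡⟨ ℤ.+-identityˡ (t n) ⟩
  t n                        ∎
  where open ≡-Reasoning

-- The difference of the two representation functions

module _ (m k : ℕ) (k≤m : k ≤ m) where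

  private
    n = m + k

    range : List ℕ
    range = upTo (suc n)

    -- The constraint shared by the solutions in `C` and in `D`, with membership in `A` or `B`
    -- dropped.
    K : ℕ → ℕ → ℤ
    K s s′ = 𝟙 (Solution? (Interval? 0 m) n (s , s′))

  R-∑ : ∀ {S} (S? : Decidable S) →
        + R S? n ≡ ∑[ s ← range ] ∑[ s′ ← range ] 𝟙 (Solution? S? n (s , s′))
  R-∑ S? = trans (length-filter-∑ (Solution? S? n) (cartesianProduct range range))
                 (∑-cartesianProduct range range λ p → 𝟙 (Solution? S? n p))

  -- The core is α α′ - (1 - α)(1 - α′) = α + α′ - 1, whose double is (2α - 1) + (2α′ - 1). Doubling
  -- keeps the computation in the integers. Here α, α′ stand for membership in `A`, ι, ι′ for the
  -- interval, ρ for the sum and order conditions.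
  pair-identity : ∀ α α′ ι ι′ ρ →
    let u  = (α ℤ.* ι) ℤ.* ((α′ ℤ.* ι′) ℤ.* ρ)
        v  = ((1ℤ ℤ.- α) ℤ.* ι) ℤ.* (((1ℤ ℤ.- α′) ℤ.* ι′) ℤ.* ρ)
        κ  = ι ℤ.* (ι′ ℤ.* ρ)
    in (u ℤ.- v) ℤ.+ (u ℤ.- v)
       ≡ κ ℤ.* (α ℤ.- (1ℤ ℤ.- α)) ℤ.+ κ ℤ.* (α′ ℤ.- (1ℤ ℤ.- α′))
  pair-identity = ℤ-Solver.solve-∀

  Δ : ℕ → ℕ → ℤ
  Δ s s′ = 𝟙 (Solution? (C? m) n (s , s′)) ℤ.- 𝟙 (Solution? (D? m) n (s , s′))

  pair-contribution : ∀ s s′ → Δ s s′ ℤ.+ Δ s s′ ≡ K s s′ ℤ.* t s ℤ.+ K s s′ ℤ.* t s′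
  pair-contribution s s′ =
    trans (lemma (A? s) (A? s′) (Interval? 0 m s) (Interval? 0 m s′)
                 ((s + s′ ≟ n) ×-dec (s <? s′)))
          (cong₂ (λ x y → K s s′ ℤ.* x ℤ.+ K s s′ ℤ.* y) (sym (t-def s)) (sym (t-def s′)))
    where
    lemma : ∀ {P P′ I I′ J : Set} (a : Dec P) (a′ : Dec P′)
            (i : Dec I) (i′ : Dec I′) (r : Dec J) →
            let u = 𝟙 ((a ×-dec i) ×-dec (a′ ×-dec i′) ×-dec r)
                v = 𝟙 ((¬? a ×-dec i) ×-dec (¬? a′ ×-dec i′) ×-dec r)
                κ = 𝟙 (i ×-dec i′ ×-dec r)
            in (u ℤ.- v) ℤ.+ (u ℤ.- v)
               ≡ κ ℤ.* (𝟙 a ℤ.- 𝟙 (¬? a)) ℤ.+ κ ℤ.* (𝟙 a′ ℤ.- 𝟙 (¬? a′))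
    lemma a a′ i i′ r
      rewrite 𝟙-× (a ×-dec i) ((a′ ×-dec i′) ×-dec r)
            | 𝟙-× (a′ ×-dec i′) r
            | 𝟙-× (¬? a ×-dec i) ((¬? a′ ×-dec i′) ×-dec r)
            | 𝟙-× (¬? a′ ×-dec i′) r
            | 𝟙-× a i | 𝟙-× a′ i′ | 𝟙-× (¬? a) i | 𝟙-× (¬? a′) i′
            | 𝟙-× i (i′ ×-dec r) | 𝟙-× i′ r | 𝟙-¬ a | 𝟙-¬ a′
      = pair-identity (𝟙 a) (𝟙 a′) (𝟙 i) (𝟙 i′) (𝟙 r)

  -- Given `s + s′ = m + k`, the bound `s′ ≤ m` amounts to `k ≤ s`. Hence `s` lies in an admissible
  -- pair, as smaller or larger entry, exactly when `k ≤ s ≤ m` and `s` is not half of `n`.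
  multiplicity : ∀ s s′ → s + s′ ≡ n →
    K s s′ ℤ.+ K s′ s ≡ 𝟙 (s <? suc m) ℤ.- 𝟙 (s <? k) ℤ.- 𝟙 (s + s ≟ n)
  multiplicity s s′ s+s′≡n = go (s ≤? m) (s <? k) (<-cmp s s′)
    where
    p? = Solution? (Interval? 0 m) n (s , s′)
    q? = Solution? (Interval? 0 m) n (s′ , s)

    -- Each case supplies the values of the five indicators; what remains is an identity between
    -- numerals.
    evaluate : ∀ {a b c d e} →
      𝟙 p? ≡ a → 𝟙 q? ≡ b → 𝟙 (s <? suc m) ≡ c → 𝟙 (s <? k) ≡ d → 𝟙 (s + s ≟ n) ≡ e →
      a ℤ.+ b ≡ c ℤ.- d ℤ.- e →
      𝟙 p? ℤ.+ 𝟙 q? ≡ 𝟙 (s <? suc m) ℤ.- 𝟙 (s <? k) ℤ.- 𝟙 (s + s ≟ n)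
    evaluate refl refl refl refl refl eq = eq

    off-diagonal : s ≢ s′ → s + s ≢ n
    off-diagonal s≢s′ eq = s≢s′ (+-cancelˡ-≡ s s s′ (trans eq (sym s+s′≡n)))

    s′≤m⇒s≮k : s′ ≤ m → ¬ s < k
    s′≤m⇒s≮k s′≤m s<k = <⇒≢ (+-mono-<-≤ s<k s′≤m) (trans s+s′≡n (+-comm m k))

    s≮k⇒s′≤m : ¬ s < k → s′ ≤ m
    s≮k⇒s′≤m s≮k = +-cancelˡ-≤ k s′ m
      (≤-trans (+-monoˡ-≤ s′ (≮⇒≥ s≮k)) (≤-reflexive (trans s+s′≡n (+-comm m k))))

    go : Dec (s ≤ m) → Dec (s < k) → Tri (s < s′) (s ≡ s′) (s′ < s) →
         𝟙 p? ℤ.+ 𝟙 q? ≡ 𝟙 (s <? suc m) ℤ.- 𝟙 (s <? k) ℤ.- 𝟙 (s + s ≟ n)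
    go (no s≰m) _ _ = evaluate
      (𝟙-no p? λ ((_ , s≤m) , _) → s≰m s≤m)
      (𝟙-no q? λ (_ , (_ , s≤m) , _) → s≰m s≤m)
      (𝟙-no (s <? suc m) λ s<1+m → s≰m (≤-pred s<1+m))
      (𝟙-no (s <? k) λ s<k → s≰m (≤-trans (<⇒≤ s<k) k≤m))
      -- Both `m < s` and `k ≤ s` hold here, so `s + s` exceeds `n`.
      (𝟙-no (s + s ≟ n) (>⇒≢ (+-mono-<-≤ (≰⇒> s≰m) (≤-trans k≤m (<⇒≤ (≰⇒> s≰m))))))
      refl
    go (yes s≤m) (yes s<k) _ = evaluate
      (𝟙-no p? λ (_ , (_ , s′≤m) , _) → s′≤m⇒s≮k s′≤m s<k)
      (𝟙-no q? λ ((_ , s′≤m) , _) → s′≤m⇒s≮k s′≤m s<k)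
      (𝟙-yes (s <? suc m) (s≤s s≤m))
      (𝟙-yes (s <? k) s<k)
      (𝟙-no (s + s ≟ n) (<⇒≢ (+-mono-≤-< s≤m s<k)))
      refl
    go (yes s≤m) (no s≮k) (tri< s<s′ s≢s′ s≯s′) = evaluate
      (𝟙-yes p? ((z≤n , s≤m) , (z≤n , s≮k⇒s′≤m s≮k) , s+s′≡n , s<s′))
      (𝟙-no q? λ (_ , _ , _ , s′<s) → s≯s′ s′<s)
      (𝟙-yes (s <? suc m) (s≤s s≤m))
      (𝟙-no (s <? k) s≮k)
      (𝟙-no (s + s ≟ n) (off-diagonal s≢s′))
      refl
    go (yes s≤m) (no s≮k) (tri≈ s≮s′ s≡s′ s≯s′) = evaluate
      (𝟙-no p? λ (_ , _ , _ , s<s′) → s≮s′ s<s′)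
      (𝟙-no q? λ (_ , _ , _ , s′<s) → s≯s′ s′<s)
      (𝟙-yes (s <? suc m) (s≤s s≤m))
      (𝟙-no (s <? k) s≮k)
      (𝟙-yes (s + s ≟ n) (trans (cong (λ z → s + z) s≡s′) s+s′≡n))
      refl
    go (yes s≤m) (no s≮k) (tri> s≮s′ s≢s′ s′<s) = evaluate
      (𝟙-no p? λ (_ , _ , _ , s<s′) → s≮s′ s<s′)
      (𝟙-yes q? ((z≤n , s≮k⇒s′≤m s≮k) , (z≤n , s≤m) , trans (+-comm s′ s) s+s′≡n , s′<s))
      (𝟙-yes (s <? suc m) (s≤s s≤m))
      (𝟙-no (s <? k) s≮k)
      (𝟙-no (s + s ≟ n) (off-diagonal s≢s′))
      refl

  -- Only `s′ = n ∸ s` can contribute, since `K` demands the sum `n` in either order.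
  ∑-multiplicity : ∀ s → s ≤ n →
    ∑[ s′ ← range ] (K s s′ ℤ.+ K s′ s)
    ≡ 𝟙 (s <? suc m) ℤ.- 𝟙 (s <? k) ℤ.- 𝟙 (s + s ≟ n)
  ∑-multiplicity s s≤n =
    trans (∑-upTo-single (suc n) (λ s′ → K s s′ ℤ.+ K s′ s) (s≤s (m∸n≤m n s)) off)
          (multiplicity s (n ∸ s) (m+[n∸m]≡n s≤n))
    where
    off : ∀ s′ → s′ ≢ n ∸ s → K s s′ ℤ.+ K s′ s ≡ 0ℤ
    off s′ s′≢ = cong₂ ℤ._+_
      (𝟙-no (Solution? (Interval? 0 m) n (s , s′)) λ (_ , _ , eq , _) →
        s′≢ (trans (sym (m+n∸m≡n s s′)) (cong (_∸ s) eq)))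
      (𝟙-no (Solution? (Interval? 0 m) n (s′ , s)) λ (_ , _ , eq , _) →
        s′≢ (trans (sym (m+n∸n≡m s′ s)) (cong (_∸ s) eq)))

  -- The correction for the pair with equal entries, which `s < s′` excludes; at most the term at
  -- `n / 2` survives.
  diagonal : ℤ
  diagonal = ∑[ s ← range ] (𝟙 (s + s ≟ n) ℤ.* t s)

  R-difference : let δ = + R (C? m) n ℤ.- + R (D? m) n in
                 δ ℤ.+ δ ≡ T (suc m) ℤ.- T k ℤ.- diagonal
  R-difference = begin
    δ ℤ.+ δ
      ≡⟨ cong (λ z → z ℤ.+ z) δ≡∑Δ ⟩
    ∑∑ Δ ℤ.+ ∑∑ Δ
      ≡⟨ ∑∑-+ Δ Δ ⟨
    ∑∑ (λ s s′ → Δ s s′ ℤ.+ Δ s s′)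
      ≡⟨ ∑-cong range (λ {s} _ → ∑-cong range λ {s′} _ → pair-contribution s s′) ⟩
    ∑∑ (λ s s′ → K s s′ ℤ.* t s ℤ.+ K s s′ ℤ.* t s′)
      ≡⟨ ∑∑-+ (λ s s′ → K s s′ ℤ.* t s) (λ s s′ → K s s′ ℤ.* t s′) ⟩
    ∑∑ (λ s s′ → K s s′ ℤ.* t s) ℤ.+ ∑∑ (λ s s′ → K s s′ ℤ.* t s′)
      -- Exchanging the summations in the second part lets every `t s` collect the coefficient
      -- `K s s′ + K s′ s`, which `∑-multiplicity` evaluates.
      ≡⟨ cong (λ z → ∑∑ (λ s s′ → K s s′ ℤ.* t s) ℤ.+ z)
           (∑-comm range range (λ s s′ → K s s′ ℤ.* t s′)) ⟩
    ∑∑ (λ s s′ → K s s′ ℤ.* t s) ℤ.+ ∑∑ (λ s s′ → K s′ s ℤ.* t s)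
      ≡⟨ ∑∑-+ (λ s s′ → K s s′ ℤ.* t s) (λ s s′ → K s′ s ℤ.* t s) ⟨
    ∑∑ (λ s s′ → K s s′ ℤ.* t s ℤ.+ K s′ s ℤ.* t s)
      ≡⟨ ∑-cong range (λ s∈ → collect _ (≤-pred (∈-upTo⁻ s∈))) ⟩
    ∑[ s ← range ] (f s ℤ.- g s ℤ.- h s)
      ≡⟨ ∑-- range (λ s → f s ℤ.- g s) h ⟩
    ∑[ s ← range ] (f s ℤ.- g s) ℤ.- diagonal
      ≡⟨ cong (ℤ._- diagonal) (∑-- range f g) ⟩
    ∑ range f ℤ.- ∑ range g ℤ.- diagonal
      ≡⟨ cong₂ (λ x y → x ℤ.- y ℤ.- diagonal)
           (∑-upTo-truncate-≤ t (s≤s (m≤m+n m k)))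
           (∑-upTo-truncate-≤ t (m≤n⇒m≤1+n (m≤n+m k m))) ⟩
    T (suc m) ℤ.- T k ℤ.- diagonal
      ∎
    where
    open ≡-Reasoning

    δ = + R (C? m) n ℤ.- + R (D? m) n

    ∑∑ : (ℕ → ℕ → ℤ) → ℤ
    ∑∑ F = ∑[ s ← range ] ∑[ s′ ← range ] F s s′

    ∑∑-+ : ∀ F G → ∑∑ (λ s s′ → F s s′ ℤ.+ G s s′) ≡ ∑∑ F ℤ.+ ∑∑ G
    ∑∑-+ F G = trans (∑-cong range (λ {s} _ → ∑-+ range (F s) (G s)))
                     (∑-+ range (λ s → ∑ range (F s)) (λ s → ∑ range (G s)))

    δ≡∑Δ : δ ≡ ∑∑ Δ
    δ≡∑Δ = trans (cong₂ ℤ._-_ (R-∑ (C? m)) (R-∑ (D? m)))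
      (sym (trans (∑-cong range λ {s} _ → ∑-- range (c s) (d s))
                  (∑-- range (λ s → ∑ range (c s)) (λ s → ∑ range (d s)))))
      where
      c d : ℕ → ℕ → ℤ
      c s s′ = 𝟙 (Solution? (C? m) n (s , s′))
      d s s′ = 𝟙 (Solution? (D? m) n (s , s′))

    f g h : ℕ → ℤ
    f s = 𝟙 (s <? suc m) ℤ.* t s
    g s = 𝟙 (s <? k) ℤ.* t s
    h s = 𝟙 (s + s ≟ n) ℤ.* t s

    distrib : ∀ x y z c →
      (x ℤ.- y ℤ.- z) ℤ.* c ≡ x ℤ.* c ℤ.- y ℤ.* c ℤ.- z ℤ.* c
    distrib = ℤ-Solver.solve-∀

    collect : ∀ s → s ≤ n →
      ∑[ s′ ← range ] (K s s′ ℤ.* t s ℤ.+ K s′ s ℤ.* t s) ≡ f s ℤ.- g s ℤ.- h s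
    collect s s≤n = begin
      ∑[ s′ ← range ] (K s s′ ℤ.* t s ℤ.+ K s′ s ℤ.* t s)
        ≡⟨ ∑-cong range (λ {s′} _ → ℤ.*-distribʳ-+ (t s) (K s s′) (K s′ s)) ⟨
      ∑[ s′ ← range ] ((K s s′ ℤ.+ K s′ s) ℤ.* t s)
        ≡⟨ ∑-*ʳ range (λ s′ → K s s′ ℤ.+ K s′ s) (t s) ⟩
      (∑[ s′ ← range ] (K s s′ ℤ.+ K s′ s)) ℤ.* t s
        ≡⟨ cong (ℤ._* t s) (∑-multiplicity s s≤n) ⟩
      (𝟙 (s <? suc m) ℤ.- 𝟙 (s <? k) ℤ.- 𝟙 (s + s ≟ n)) ℤ.* t s
        ≡⟨ distrib (𝟙 (s <? suc m)) (𝟙 (s <? k)) (𝟙 (s + s ≟ n)) (t s) ⟩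
      f s ℤ.- g s ℤ.- h s ∎

  diagonal-odd : (∀ h → h + h ≢ n) → diagonal ≡ 0ℤ
  diagonal-odd odd = ∑-zero range λ {s} _ → cong (ℤ._* t s) (𝟙-no (s + s ≟ n) (odd s))

  diagonal-even : ∀ h → h + h ≡ n → diagonal ≡ t h
  diagonal-even h h+h≡n = begin
    diagonal                   ≡⟨ ∑-upTo-single (suc n) (λ s → 𝟙 (s + s ≟ n) ℤ.* t s)
                                    (s≤s (≤-trans (m≤m+n h h) (≤-reflexive h+h≡n))) off ⟩
    𝟙 (h + h ≟ n) ℤ.* t h      ≡⟨ cong (ℤ._* t h) (𝟙-yes (h + h ≟ n) h+h≡n) ⟩
    1ℤ ℤ.* t h                 ≡⟨ ℤ.*-identityˡ (t h) ⟩
    t h                        ∎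
    where
    open ≡-Reasoning
    double-injective : ∀ s → s + s ≡ h + h → s ≡ h
    double-injective s eq with <-cmp s h
    ... | tri< s<h _ _ = contradiction eq (<⇒≢ (+-mono-< s<h s<h))
    ... | tri≈ _ s≡h _ = s≡h
    ... | tri> _ _ h<s = contradiction (sym eq) (<⇒≢ (+-mono-< h<s h<s))
    off : ∀ s → s ≢ h → 𝟙 (s + s ≟ n) ℤ.* t s ≡ 0ℤ
    off s s≢h = cong (ℤ._* t s)
      (𝟙-no (s + s ≟ n) λ eq → s≢h (double-injective s (trans eq (sym h+h≡n))))

  R≢ : T (suc m) ℤ.- T k ℤ.- diagonal ≢ 0ℤ → R (C? m) n ≢ R (D? m) n
  R≢ ≢0 eq = ≢0 (trans (sym R-difference)
    (cong (λ z → z ℤ.+ z) (ℤ.i≡j⇒i-j≡0 (cong +_ eq))))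

-- Translates of the Thue–Morse sequence

Power : ℕ → Set
Power p = ∃ λ l → p ≡ 2 ^ l

-- For `m = 2p − 1` and `k = 2j + 1` the bound `k < m` reads `j + 2 ≤ p`, and the equality of signs
-- keeps `t j` and `t (p + j)` from cancelling.
Agreement : ℕ → Set
Agreement p = ∃ λ j → j + 2 ≤ p × t (p + j) ≡ t j

power⊎agreement : ∀ p → 0 < p → Power p ⊎ Agreement p
power⊎agreement = <-rec (λ p → 0 < p → Power p ⊎ Agreement p) step
  where
  step : ∀ p → (∀ {q} → q < p → 0 < q → Power q ⊎ Agreement q) →
         0 < p → Power p ⊎ Agreement p
  step p rec 0<p with p divMod 2
  step p rec () | result zero zero refl
  step p rec 0<p | result (suc q) zero refl
    with rec (m<m*n (suc q) 2 (s<s z<s)) z<s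
  ... | inj₁ (l , eq) = inj₁ (suc l , trans (*-comm (suc q) 2) (cong (2 *_) eq))
  -- Doubling an argument preserves `t`, so a solution `j` for half of `p` yields `2j` for `p`; the
  -- bound survives with room to spare.
  ... | inj₂ (j , j+2≤ , eq) = inj₂ (j * 2 , bound , agree)
    where
    bound : j * 2 + 2 ≤ suc q * 2
    bound = ≤-trans (+-monoʳ-≤ (j * 2) (s≤s (s≤s z≤n)))
      (≤-trans (≤-reflexive (sym (*-distribʳ-+ 2 j 2))) (*-monoˡ-≤ 2 j+2≤))
    agree : t (suc q * 2 + j * 2) ≡ t (j * 2)
    agree = trans (cong t (sym (*-distribʳ-+ 2 (suc q) j)))
      (trans (t-even (suc q + j)) (trans eq (sym (t-even j))))
  step p rec 0<p | result zero (suc zero) refl = inj₁ (0 , refl)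
  -- The case `p = 3` is separate because the choice `j = 2`, available for larger odd `p`, would
  -- violate `j + 2 ≤ p`.
  step p rec 0<p | result (suc zero) (suc zero) refl = 
    inj₂ (0 , s≤s (s≤s z≤n) , trans t-3 (sym t-0))
  -- Now t (p + 1) = r and t (p + 2) = − r with r = t (q + 3), while t 1 = t 2 = − 1.
  step p rec 0<p | result (suc (suc q)) (suc zero) refl with t-±1 (3 + q)
  ... | inj₁ r≡1 = inj₂ (2 , s≤s (s≤s (s≤s (s≤s z≤n))) ,
    trans (cong t (+-comm (suc (suc (suc q) * 2)) 2))
          (trans (t-odd (3 + q)) (trans (cong ℤ.-_ r≡1) (sym t-2))))
  ... | inj₂ r≡-1 = inj₂ (1 , s≤s (s≤s (s≤s z≤n)) ,
    trans (cong t (+-comm (suc (suc (suc q) * 2)) 1))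
          (trans (t-even (3 + q)) (trans r≡-1 (sym t-1))))

double≢odd : ∀ h r → h + h ≢ suc (r * 2)
double≢odd h r eq = m*2≢1+n*2 h r
  (trans (*-comm h 2) (trans (cong (λ z → h + z) (+-identityʳ h)) eq))

-- Choosing `n = m + k` according to the parity of `m`.

Witness : ℕ → Set
Witness m = ∃ λ n → 0 < n × m < n × n < 2 * m × R (C? m) n ≢ R (D? m) n

witness : ∀ m k → 0 < k → (k<m : k < m) →
          T (suc m) ℤ.- T k ℤ.- diagonal m k (<⇒≤ k<m) ≢ 0ℤ → Witness m
witness m k 0<k k<m ≢0 =
  m + k , ≤-trans 0<k (m≤n+m k m) , m<m+n m 0<k ,
  +-monoʳ-< m (≤-trans k<m (≤-reflexive (sym (+-identityʳ m)))) ,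
  R≢ m k (<⇒≤ k<m) ≢0

-- With `k = 2j + 1` the number `n` is odd, so the diagonal vanishes and the doubled difference is
-- `t (q + 1) − t j`. As `t 0` and `t 1` are opposite, `j = 0` or `j = 1` makes it nonzero.
witness-even : ∀ q → Witness (suc q * 2)
witness-even q = go (t-±1 (suc q))
  where
  m = suc q * 2

  value : ∀ j (k<m : suc (j * 2) < m) →
          T (suc m) ℤ.- T (suc (j * 2)) ℤ.- diagonal m (suc (j * 2)) (<⇒≤ k<m)
          ≡ t (suc q) ℤ.- t j ℤ.- 0ℤ
  value j k<m = cong₂ ℤ._-_ (cong₂ ℤ._-_ (T-odd (suc q)) (T-odd j))
    (diagonal-odd m (suc (j * 2)) (<⇒≤ k<m) λ h eq → double≢odd h (suc q + j)
      (trans eq (trans (+-suc m (j * 2)) (cong suc (sym (*-distribʳ-+ 2 (suc q) j))))))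

  nonzero : ∀ {x y} → x ≡ 1ℤ × y ≡ -1ℤ ⊎ x ≡ -1ℤ × y ≡ 1ℤ → x ℤ.- y ℤ.- 0ℤ ≢ 0ℤ
  nonzero (inj₁ (refl , refl)) ()
  nonzero (inj₂ (refl , refl)) ()

  go : t (suc q) ≡ 1ℤ ⊎ t (suc q) ≡ -1ℤ → Witness m
  go (inj₂ t≡-1) = witness m 1 z<s 1<m λ eq →
    nonzero (inj₂ (t≡-1 , t-0)) (trans (sym (value 0 1<m)) eq)
    where
    1<m : 1 < m
    1<m = s≤s (s≤s z≤n)
  go (inj₁ t≡1) = witness m 3 z<s 3<m λ eq →
    nonzero (inj₁ (t≡1 , t-1)) (trans (sym (value 1 3<m)) eq)
    where
    -- Taking `k = 3` needs `m > 3`. The exception `m = 2` cannot occur in this branch, because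
    -- `t 1 = −1`.
    q≢0 : q ≢ 0
    q≢0 refl = contradiction (trans (sym t≡1) t-1) λ ()
    3<m : 3 < m
    3<m = s≤s (s≤s (*-monoˡ-≤ 2 (n≢0⇒n>0 q≢0)))

-- With `p = q + 1` the half of `n` is `p + j`. The sum up to `m` has even length and vanishes, so
-- the agreement turns the doubled difference into `− 2 t j`.
witness-odd : ∀ q → Agreement (suc q) → Witness (suc (q * 2))
witness-odd q (j , j+2≤1+q , agree) = witness m k z<s k<m λ eq →
  nonzero (trans (sym value) eq)
  where
  m = suc (q * 2)
  k = suc (j * 2)

  k<m : k < m
  k<m = s≤s (≤-trans (n≤1+n _) (*-monoˡ-≤ 2 (≤-pred (subst (_≤ suc q) (+-comm j 2) j+2≤1+q))))

  half : ∀ q j → (suc q + j) + (suc q + j) ≡ suc (q * 2) + suc (j * 2)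
  half = solve-∀

  value : T (suc m) ℤ.- T k ℤ.- diagonal m k (<⇒≤ k<m) ≡ 0ℤ ℤ.- t j ℤ.- t j
  value = cong₂ ℤ._-_ (cong₂ ℤ._-_ (T-even (suc q)) (T-odd j))
    (trans (diagonal-even m k (<⇒≤ k<m) (suc q + j) (half q j)) agree)

  nonzero : 0ℤ ℤ.- t j ℤ.- t j ≢ 0ℤ
  nonzero eq with t-±1 j
  ... | inj₁ t≡1  = contradiction (trans (cong (λ z → 0ℤ ℤ.- z ℤ.- z) (sym t≡1)) eq) λ ()
  ... | inj₂ t≡-1 = contradiction (trans (cong (λ z → 0ℤ ℤ.- z ℤ.- z) (sym t≡-1)) eq) λ ()

witness-exists : ∀ m → 0 < m → ¬ (∃ λ l → m ≡ 2 ^ l ∸ 1) → DivMod m 2 → Witness m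
witness-exists _ () _ (result zero zero refl)
witness-exists _ _ _ (result (suc q) zero refl) = witness-even q
witness-exists _ _ m≢2^l∸1 (result q (suc zero) refl) = go (power⊎agreement (suc q) z<s)
  where
  go : Power (suc q) ⊎ Agreement (suc q) → Witness (suc (q * 2))
  -- Here `m + 1 = 2 (q + 1) = 2 ^ (l + 1)`, the excluded form.
  go (inj₁ (l , 1+q≡2^l)) = contradiction
    (suc l , cong (_∸ 1) (trans (*-comm (suc q) 2) (cong (2 *_) 1+q≡2^l))) m≢2^l∸1
  go (inj₂ agreement) = witness-odd q agreement

corollary1 : ∀ (m : ℕ) → 0 < m → ¬ (∃ λ l → m ≡ 2 ^ l ∸ 1) →
    ∃ λ n → 0 < n × m < n × n < 2 * m × R (C? m) n ≢ R (D? m) n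
corollary1 m 0<m m≢2^l∸1 = witness-exists m 0<m m≢2^l∸1 (m divMod 2)
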